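{- For all integers $t \geq 2$ and $n \geq 3$, the Dutch windmill graph $D_n^{(t)}$ is $2n$-periodic. For all positive integers $t$ and $n$, the uniform theta graph $\Theta(t,n)$ is $(2n+2)$-periodic.
   Context: Graphs are simple and finite. For a graph $G=(V,E)$, let $d_x$ be the degree of a vertex $x$ and let $\mathcal{A}=\{(x,y),(y,x) \mid \{x,y\}\in E\}$ be the set of symmetric arcs. For an arc $a=(x,y)$ write $o(a)=x$ (origin), $t(a)=y$ (terminus) and $a^{ -1}=(y,x)$. The time evolution matrix of the Grover walk on $G$ is $U=U(G)\in\mathbb{C}^{\mathcal{A}\times\mathcal{A}}$ with entries \[ U_{a,b} = \frac{2}{d_{t(b)}}\,\delta_{o(a),t(b)} - \delta_{a,b^{ -1}}, \] where $\delta$ is the Kronecker delta. For a positive integer $\tau$, $G$ is called $\tau$-periodic if $\tau$ is the smallest positive integer with $U(G)^\tau = I$. The Dutch windmill graph $D_n^{(t)}$ is obtained from $t$ disjoint copies of the cycle graph $C_n$ on $n$ vertices by identifying one vertex from each copy into a single common vertex. The uniform theta graph $\Theta(t,n)$ is obtained from $t$ pairwise vertex-disjoint path graphs on $n$ vertices by adding two new vertices and, for each path, joining one endpoint to the first new vertex and the other endpoint to the second new vertex (when $n=1$ the single vertex of each path is joined to both new vertices). -}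

module Defs where

open import Data.Bool.Base using (if_then_else_)
open import Data.Fin.Base using (Fin; zero; suc; toℕ)
open import Data.Fin.Patterns using (0F; 1F)
import Data.Fin.Properties as Fin
open import Data.Integer.Base using (+_)
open import Data.Nat.Base as ℕ using (ℕ; zero; suc; NonZero; _≤_; _<_; s≤s)
import Data.Nat.Properties as ℕ
open import Data.Product.Base using (_×_; _,_; ∃-syntax)
import Data.Product.Properties as Product
open import Data.Rational.Base using (ℚ; 0ℚ; 1ℚ; _/_; _*_; _-_)
import Data.Rational.Properties as ℚ
open import Data.Sum.Base using (_⊎_; inj₁; inj₂)
import Data.Sum.Properties as Sum
open import Data.Sum.Function.Propositional using (_⊎-↔_)
open import Data.Unit.Base using (⊤; tt)
import Data.Unit.Properties as Unit
open import Data.Vec.Functional using (Vector)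
open import Function.Base using (_∘_)
open import Function.Bundles using (_↔_; Inverse)
open import Function.Construct.Composition using (_↔-∘_)
open import Function.Construct.Identity using (↔-id)
open import Level using (0ℓ)
open import Relation.Binary.Construct.Closure.Symmetric
  using (SymClosure; fwd; bwd; symmetric)
open import Relation.Binary.Core using (Rel)
open import Relation.Binary.Definitions
  using (Decidable; DecidableEquality; Irreflexive; Symmetric)
open import Relation.Binary.PropositionalEquality
  using (_≡_; refl; sym; trans; cong; subst)
open import Relation.Nullary.Decidable
  using (Dec; yes; no; does; map′; recompute; _×-dec_; _⊎-dec_)
open import Relation.Nullary.Negation using (contradiction)

open import Algebra.Bundles using (CommutativeRing)
open import Algebra.Properties.Semiring.Sum ℕ.+-*-semiring
  using () renaming (sum to sumℕ)
open import Algebra.Properties.Semiring.Sum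
  (CommutativeRing.semiring ℚ.+-*-commutativeRing)
  using () renaming (sum to sumℚ)

record Graph : Set₁ where
  infix 4 _~_ _~?_ _≟_
  field
    V           : Set
    order       : ℕ
    enumeration : Fin order ↔ V
    _≟_         : DecidableEquality V
    _~_         : Rel V 0ℓ
    _~?_        : Decidable _~_
    ~-sym       : Symmetric _~_
    ~-irrefl    : Irreflexive _≡_ _~_

  vertex : Vector V order
  vertex = Inverse.to enumeration

  degree : V → ℕ
  degree x = sumℕ λ i → if does (x ~? vertex i) then 1 else 0

  -- The adjacency proof is irrelevant, so an arc is determined by its
  -- ordered pair of endpoints even if `x ~ y` has several proofs.
  record Arc : Set where
    eta-equality
    constructor arc
    field
      origin    : V
      terminus  : V
      .adjacent : origin ~ terminus

  open Arc public

  _⁻¹ : Arc → Arc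
  arc x y p ⁻¹ = arc y x (~-sym p)

  _≟ᴬ_ : DecidableEquality Arc
  arc x y _ ≟ᴬ arc x′ y′ _ =
    map′ (λ { (refl , refl) → refl }) (λ { refl → refl , refl })
         ((x ≟ x′) ×-dec (y ≟ y′))

private
  sumℕ-pos : ∀ {n} (f : Vector ℕ n) i → 0 < f i → 0 < sumℕ f
  sumℕ-pos f zero    0<fi = ℕ.≤-trans 0<fi (ℕ.m≤m+n _ _)
  sumℕ-pos f (suc i) 0<fi =
    ℕ.≤-trans (sumℕ-pos (f ∘ suc) i 0<fi) (ℕ.m≤n+m _ (f zero))

module _ (G : Graph) where
  open Graph G

  degree-pos : ∀ {x y} → x ~ y → 0 < degree x
  degree-pos {x} {y} x~y = sumℕ-pos _ (Inverse.from enumeration y) 0<indicator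
    where
    indicator-pos : ∀ {z} → x ~ z → 0 < (if does (x ~? z) then 1 else 0)
    indicator-pos {z} x~z with x ~? z
    ... | yes _   = s≤s ℕ.z≤n
    ... | no  x≁z = contradiction x~z x≁z

    0<indicator : 0 < (if does (x ~? vertex (Inverse.from enumeration y)) then 1 else 0)
    0<indicator = indicator-pos
      (subst (x ~_) (sym (Inverse.strictlyInverseˡ enumeration y)) x~y)

  terminus-degree-nonZero : (a : Arc) → NonZero (degree (terminus a))
  terminus-degree-nonZero (arc x y p) = ℕ.≢-nonZero d≢0
    where
    d≢0 : degree y ≡ 0 → _
    d≢0 d≡0 = ℕ.<⇒≢ (degree-pos (~-sym (recompute (x ~? y) p))) (sym d≡0)

  -- Square matrices with rows and columns indexed by the arcs.  All entries
  -- of the Grover walk's time evolution matrix are rational, so ℚ stands in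
  -- for the complex numbers.
  Matrix : Set
  Matrix = Arc → Arc → ℚ

  infix 4 _≈_
  _≈_ : Rel Matrix 0ℓ
  A ≈ B = ∀ a b → A a b ≡ B a b

  δ : {A : Set} → DecidableEquality A → A → A → ℚ
  δ _≟′_ x y = if does (x ≟′ y) then 1ℚ else 0ℚ

  valueIfArc : (Arc → ℚ) → ∀ x y → Dec (x ~ y) → ℚ
  valueIfArc f x y (yes p) = f (arc x y p)
  valueIfArc f x y (no  _) = 0ℚ

  -- Sum over all arcs, as a sum over all ordered pairs of vertices in which
  -- the non-adjacent pairs contribute 0.
  sumArc : (Arc → ℚ) → ℚ
  sumArc f = sumℚ λ i → sumℚ λ j →
    valueIfArc f (vertex i) (vertex j) (vertex i ~? vertex j)

  identity : Matrix
  identity = δ _≟ᴬ_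

  infixl 7 _⊗_
  _⊗_ : Matrix → Matrix → Matrix
  (A ⊗ B) a b = sumArc λ c → A a c * B c b

  infixr 8 _^_
  _^_ : Matrix → ℕ → Matrix
  A ^ zero  = identity
  A ^ suc k = A ⊗ (A ^ k)

  grover : Matrix
  grover a b =
    ((+ 2) / degree (terminus b)) {{terminus-degree-nonZero b}}
      * δ _≟_ (origin a) (terminus b)
    - δ _≟ᴬ_ a (b ⁻¹)

  IsPeriodic : ℕ → Set
  IsPeriodic τ =
      0 < τ
    × grover ^ τ ≈ identity
    × (∀ σ → 0 < σ → grover ^ σ ≈ identity → τ ≤ σ)

symClosure? : {A : Set} {R : Rel A 0ℓ} → Decidable R → Decidable (SymClosure R)
symClosure? R? x y =
  map′ (λ { (inj₁ r) → fwd r ; (inj₂ r) → bwd r })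
       (λ { (fwd r) → inj₁ r ; (bwd r) → inj₂ r })
       (R? x y ⊎-dec R? y x)

symClosure-irrefl : {A : Set} {R : Rel A 0ℓ} →
                    Irreflexive _≡_ R → Irreflexive _≡_ (SymClosure R)
symClosure-irrefl irr x≡y (fwd r) = irr x≡y r
symClosure-irrefl irr x≡y (bwd r) = irr (sym x≡y) r

PathNext : (n : ℕ) → Rel (Fin n) 0ℓ
PathNext n j k = suc (toℕ j) ≡ toℕ k

path : ℕ → Graph
path n = record
  { V           = Fin n
  ; order       = n
  ; enumeration = ↔-id _
  ; _≟_         = Fin._≟_
  ; _~_         = SymClosure (PathNext n)
  ; _~?_        = symClosure? λ j k → suc (toℕ j) ℕ.≟ toℕ k
  ; ~-sym       = symmetric (PathNext n)
  ; ~-irrefl    = symClosure-irrefl λ { refl eq → ℕ.1+n≢n eq }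
  }

CycleNext : (n : ℕ) → Rel (Fin n) 0ℓ
CycleNext n j k = suc (toℕ j) ≡ toℕ k ⊎ (suc (toℕ j) ≡ n × toℕ k ≡ 0)

cycleNext-irrefl : ∀ {n} → 3 ≤ n → Irreflexive _≡_ (CycleNext n)
cycleNext-irrefl 3≤n refl (inj₁ eq)            = ℕ.1+n≢n eq
cycleNext-irrefl 3≤n refl (inj₂ (1+j≡n , j≡0)) =
  ℕ.<⇒≢ (ℕ.≤-trans (s≤s (s≤s ℕ.z≤n)) 3≤n) (trans (cong suc (sym j≡0)) 1+j≡n)

cycle : (n : ℕ) → 3 ≤ n → Graph
cycle n 3≤n = record
  { V           = Fin n
  ; order       = n
  ; enumeration = ↔-id _
  ; _≟_         = Fin._≟_
  ; _~_         = SymClosure (CycleNext n)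
  ; _~?_        = symClosure? λ j k →
                    (suc (toℕ j) ℕ.≟ toℕ k)
                    ⊎-dec ((suc (toℕ j) ℕ.≟ n) ×-dec (toℕ k ℕ.≟ 0))
  ; ~-sym       = symmetric (CycleNext n)
  ; ~-irrefl    = symClosure-irrefl (cycleNext-irrefl 3≤n)
  }

-- The vertices of the windmill on t copies of a cycle with 1 + m vertices:
-- `inj₁ tt` is the common vertex, to which vertex 0 of every copy is sent, and
-- `inj₂ (i , j)` is vertex `suc j` of the i-th copy.
WindmillV : (t m : ℕ) → Set
WindmillV t m = ⊤ ⊎ (Fin t × Fin m)

windmillV-≟ : ∀ {t m} → DecidableEquality (WindmillV t m)
windmillV-≟ = Sum.≡-dec Unit._≟_ (Product.≡-dec Fin._≟_ Fin._≟_)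

glue : ∀ {t m} → Fin t → Fin (suc m) → WindmillV t m
glue i zero    = inj₁ tt
glue i (suc j) = inj₂ (i , j)

glue-injective : ∀ {t m} (i : Fin t) (u v : Fin (suc m)) →
                 glue i u ≡ glue i v → u ≡ v
glue-injective i zero    zero    _    = refl
glue-injective i (suc _) (suc _) refl = refl

WindmillAdj : (t m : ℕ) → 3 ≤ suc m → Rel (WindmillV t m) 0ℓ
WindmillAdj t m 3≤n x y =
  ∃[ i ] ∃[ u ] ∃[ v ] (u ~ v × glue i u ≡ x × glue i v ≡ y)
  where open Graph (cycle (suc m) 3≤n) using (_~_)

windmill : (t n : ℕ) → 3 ≤ n → Graph
windmill t n@(suc m) 3≤n = record
  { V           = WindmillV t m
  ; order       = 1 ℕ.+ t ℕ.* m
  ; enumeration = (Fin.1↔⊤ ⊎-↔ Fin.*↔×) ↔-∘ Fin.+↔⊎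
  ; _≟_         = windmillV-≟
  ; _~_         = WindmillAdj t m 3≤n
  ; _~?_        = λ x y → Fin.any? λ i → Fin.any? λ u → Fin.any? λ v →
                    (u C.~? v)
                    ×-dec (windmillV-≟ (glue i u) x ×-dec windmillV-≟ (glue i v) y)
  ; ~-sym       = λ { (i , u , v , u~v , p , q) → i , v , u , C.~-sym u~v , q , p }
  ; ~-irrefl    = λ { x≡y (i , u , v , u~v , p , q) →
                      C.~-irrefl (glue-injective i u v (trans p (trans x≡y (sym q)))) u~v }
  }
  where module C = Graph (cycle n 3≤n)

-- The vertices of the uniform theta graph: the two new vertices, and
-- `inj₂ (i , j)` for vertex j of the i-th path.
ThetaV : (t n : ℕ) → Set
ThetaV t n = Fin 2 ⊎ (Fin t × Fin n)

data ThetaEdge (t n : ℕ) : Rel (ThetaV t n) 0ℓ where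
  inPath   : ∀ {i j k} → Graph._~_ (path n) j k →
             ThetaEdge t n (inj₂ (i , j)) (inj₂ (i , k))
  toFirst  : ∀ {i j} → toℕ j ≡ 0 →
             ThetaEdge t n (inj₁ 0F) (inj₂ (i , j))
  toSecond : ∀ {i j} → suc (toℕ j) ≡ n →
             ThetaEdge t n (inj₁ 1F) (inj₂ (i , j))

thetaEdge? : ∀ t n → Decidable (ThetaEdge t n)
thetaEdge? t n (inj₁ _)  (inj₁ _)       = no λ ()
thetaEdge? t n (inj₁ 0F) (inj₂ (i , j)) =
  map′ toFirst (λ { (toFirst p) → p }) (toℕ j ℕ.≟ 0)
thetaEdge? t n (inj₁ 1F) (inj₂ (i , j)) =
  map′ toSecond (λ { (toSecond p) → p }) (suc (toℕ j) ℕ.≟ n)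
thetaEdge? t n (inj₂ _)  (inj₁ _)       = no λ ()
thetaEdge? t n (inj₂ (i , j)) (inj₂ (i′ , k)) =
  map′ (λ { (refl , p) → inPath p }) (λ { (inPath p) → refl , p })
       ((i Fin.≟ i′) ×-dec Graph._~?_ (path n) j k)

theta : (t n : ℕ) → Graph
theta t n = record
  { V           = ThetaV t n
  ; order       = 2 ℕ.+ t ℕ.* n
  ; enumeration = (↔-id _ ⊎-↔ Fin.*↔×) ↔-∘ Fin.+↔⊎
  ; _≟_         = Sum.≡-dec Fin._≟_ (Product.≡-dec Fin._≟_ Fin._≟_)
  ; _~_         = SymClosure (ThetaEdge t n)
  ; _~?_        = symClosure? (thetaEdge? t n)
  ; ~-sym       = symmetric (ThetaEdge t n)
  ; ~-irrefl    = symClosure-irrefl λ { refl (inPath p) → Graph.~-irrefl (path n) refl p }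
  }

{-# OPTIONS --safe #-}
module Submission where

-- Both graphs consist of t strands of L edges whose inner vertices have degree 2,
-- where the Grover walk transmits perfectly.  So in L steps every directed strand
-- is traversed exactly once and scattered once at a junction: U^L acts on each
-- layer of arcs at equal distance along the directed strands as the same matrix,
-- a coin followed by reversal.  Coin and reversal are commuting involutions,
-- hence U^(2L) = I.  For the minimality, an amplitude on the first arc of a strand
-- moves to another arc in fewer than L steps; U^L is not I because scattering is
-- not trivial; and if U^σ = I with L < σ < 2L then also U^(2L - σ) = I.

open import Defs
open import Algebra.Bundles using (CommutativeMonoid; CommutativeRing)
open import Data.Bool.Base using (if_then_else_)
open import Data.Fin.Base using (Fin; zero; suc; toℕ; fromℕ<; opposite; combine; remQuot)
open import Data.Fin.Patterns using (0F; 1F)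
import Data.Fin.Properties as Fin
open import Data.Integer.Base using (+_) renaming (_+_ to _+ℤ_; _*_ to _*ℤ_)
import Data.Integer.Properties as ℤ
open import Data.Nat.Base as ℕ using (ℕ; zero; suc; NonZero; _≤_; _<_; _+_; _*_; _∸_; s≤s)
import Data.Nat.Properties as ℕ
open import Data.Product.Base using (_×_; _,_; proj₁; proj₂; ∃-syntax)
open import Data.Rational.Base using (ℚ; 0ℚ; 1ℚ; _/_; fromℚᵘ)
  renaming (_+_ to _+ℚ_; _*_ to _*ℚ_; _-_ to _-ℚ_; -_ to -ℚ_)
import Data.Rational.Properties as ℚ
open import Data.Rational.Solver using (module +-*-Solver)
open import Data.Rational.Unnormalised.Base as ℚᵘ using (mkℚᵘ; *≡*)
import Data.Rational.Unnormalised.Properties as ℚᵘ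
open import Data.Sum.Base as Sum using (_⊎_; inj₁; inj₂)
import Data.Sum.Properties as Sum
open import Data.Unit.Base using (tt)
open import Data.Vec.Functional using (Vector)
open import Function.Base using (_∘_)
open import Function.Bundles using (Inverse)
open import Function.Definitions using (Injective)
open import Relation.Binary.Construct.Closure.Symmetric using (fwd; bwd)
open import Relation.Binary.Definitions using (DecidableEquality; tri<; tri≈; tri>)
open import Relation.Binary.PropositionalEquality
  using (_≡_; _≢_; refl; sym; trans; cong; cong₂; subst; subst₂; module ≡-Reasoning)
open import Relation.Nullary.Decidable using (Dec; yes; no; does; recompute; dec-true; dec-false)
open import Relation.Nullary.Negation using (¬_; contradiction)

-- Finite sums with restricted support

module SumSupport {a ℓ} (M : CommutativeMonoid a ℓ) where
  open CommutativeMonoid M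
    using (Carrier; ε; setoid; ∙-congˡ; ∙-congʳ; identityˡ; identityʳ)
    renaming (_≈_ to _≈ᴹ_; refl to ≈-refl; sym to ≈-sym; trans to ≈-trans)
  open import Algebra.Properties.CommutativeMonoid.Sum M
  open import Relation.Binary.Reasoning.Setoid setoid

  sum-zero : ∀ {n} {f : Vector Carrier n} → (∀ i → f i ≈ᴹ ε) → sum f ≈ᴹ ε
  sum-zero {n} f≈ε = ≈-trans (sum-cong-≋ f≈ε) (sum-replicate-zero n)

  sum-single : ∀ {n} {f : Vector Carrier n} j →
               (∀ i → i ≢ j → f i ≈ᴹ ε) → sum f ≈ᴹ f j
  sum-single zero f≈ε =
    ≈-trans (∙-congˡ (sum-zero λ i → f≈ε (suc i) λ ())) (identityʳ _)
  sum-single (suc j) f≈ε =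
    ≈-trans (∙-congʳ (f≈ε zero λ ()))
    (≈-trans (identityˡ _)
             (sum-single j λ i i≢j → f≈ε (suc i) (i≢j ∘ Fin.suc-injective)))

  -- By double counting, since h i is the sum over k of the terms [e k ≡ i] h i.
  sum-reindex : ∀ {d n} (e : Fin d → Fin n) → Injective _≡_ _≡_ e →
                (h : Vector Carrier n) →
                (∀ i → (∀ k → e k ≢ i) → h i ≈ᴹ ε) → sum h ≈ᴹ sum (h ∘ e)
  sum-reindex {d} {n} e e-inj h h≈ε = begin
    sum h                                    ≈⟨ sum-cong-≋ expand ⟩
    sum (λ i → sum (λ k → term i k))         ≈⟨ ∑-comm term ⟩
    sum (λ k → sum (λ i → term i k))         ≈⟨ sum-cong-≋ collapse ⟩
    sum (h ∘ e)                              ∎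
    where
    term : Fin n → Fin d → Carrier
    term i k = if does (e k Fin.≟ i) then h i else ε

    term-yes : ∀ {i k} → e k ≡ i → term i k ≈ᴹ h i
    term-yes {i} {k} eq with e k Fin.≟ i
    ... | yes _  = ≈-refl
    ... | no neq = contradiction eq neq

    term-no : ∀ {i k} → e k ≢ i → term i k ≈ᴹ ε
    term-no {i} {k} neq with e k Fin.≟ i
    ... | yes eq = contradiction eq neq
    ... | no _   = ≈-refl

    expand : ∀ i → h i ≈ᴹ sum (term i)
    expand i with Fin.any? (λ k → e k Fin.≟ i)
    ... | yes (k , eq) = ≈-sym (≈-trans
            (sum-single k λ l l≢k → term-no λ eq′ → l≢k (e-inj (trans eq′ (sym eq))))
            (term-yes eq))
    ... | no none = ≈-trans (h≈ε i λ k eq → none (k , eq))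
            (≈-sym (sum-zero λ k → term-no λ eq → none (k , eq)))

    collapse : ∀ k → sum (λ i → term i k) ≈ᴹ h (e k)
    collapse k = ≈-trans
      (sum-single (e k) λ i i≢ → term-no (i≢ ∘ sym))
      (term-yes refl)

module ℕ-Sum where
  open SumSupport ℕ.+-0-commutativeMonoid public
  open import Algebra.Properties.CommutativeMonoid.Sum ℕ.+-0-commutativeMonoid public

module ℚ-Sum where
  open SumSupport ℚ.+-0-commutativeMonoid public
  open import Algebra.Properties.Semiring.Sum
    (CommutativeRing.semiring ℚ.+-*-commutativeRing) public

open ℚ-Sum using (sum)

-- Rational arithmetic of the coin weight 2/d

fromℚᵘ-homo-+ : ∀ p q → fromℚᵘ (p ℚᵘ.+ q) ≡ fromℚᵘ p +ℚ fromℚᵘ q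
fromℚᵘ-homo-+ p q = ℚ.toℚᵘ-injective
  (ℚᵘ.≃-trans (ℚ.toℚᵘ-fromℚᵘ (p ℚᵘ.+ q)) (ℚᵘ.≃-sym
    (ℚᵘ.≃-trans (ℚ.toℚᵘ-homo-+ (fromℚᵘ p) (fromℚᵘ q))
      (ℚᵘ.+-cong (ℚ.toℚᵘ-fromℚᵘ p) (ℚ.toℚᵘ-fromℚᵘ q)))))

fromℚᵘ-homo-* : ∀ p q → fromℚᵘ (p ℚᵘ.* q) ≡ fromℚᵘ p *ℚ fromℚᵘ q
fromℚᵘ-homo-* p q = ℚ.toℚᵘ-injective
  (ℚᵘ.≃-trans (ℚ.toℚᵘ-fromℚᵘ (p ℚᵘ.* q)) (ℚᵘ.≃-sym
    (ℚᵘ.≃-trans (ℚ.toℚᵘ-homo-* (fromℚᵘ p) (fromℚᵘ q))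
      (ℚᵘ.*-cong (ℚ.toℚᵘ-fromℚᵘ p) (ℚ.toℚᵘ-fromℚᵘ q)))))

sum-const : ∀ n q → sum {n} (λ _ → q) ≡ (+ n / 1) *ℚ q
sum-const zero    q = sym (ℚ.*-zeroˡ q)
sum-const (suc n) q = begin
  q +ℚ sum {n} (λ _ → q)     ≡⟨ cong (q +ℚ_) (sum-const n q) ⟩
  q +ℚ (+ n / 1) *ℚ q        ≡⟨ cong (_+ℚ (+ n / 1) *ℚ q) (ℚ.*-identityˡ q) ⟨
  1ℚ *ℚ q +ℚ (+ n / 1) *ℚ q  ≡⟨ ℚ.*-distribʳ-+ q 1ℚ (+ n / 1) ⟨
  (1ℚ +ℚ + n / 1) *ℚ q
    -- `fromℚᵘ (mkℚᵘ z k)` unfolds to `z / suc k`, so the fractions can be added unnormalised and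
    -- compared by cross-multiplication.
    ≡⟨ cong (_*ℚ q) (fromℚᵘ-homo-+ (mkℚᵘ (+ 1) 0) (mkℚᵘ (+ n) 0)) ⟨
  fromℚᵘ (mkℚᵘ (+ 1) 0 ℚᵘ.+ mkℚᵘ (+ n) 0) *ℚ q
    ≡⟨ cong (_*ℚ q) (ℚ.fromℚᵘ-cong
         {mkℚᵘ (+ 1) 0 ℚᵘ.+ mkℚᵘ (+ n) 0} {mkℚᵘ (+ suc n) 0}
         (*≡* (cong (λ z → (+ 1 +ℤ z) *ℤ + 1) (ℤ.*-identityʳ (+ n))))) ⟩
  (+ suc n / 1) *ℚ q         ∎
  where open ≡-Reasoning

twoOver : (d : ℕ) .{{_ : NonZero d}} → ℚ
twoOver d = + 2 / d

-- The source of the coin being an involution: 2/d times a sum over d terms is twice the average,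
-- and the average of a constant is that constant.
twoOver-sum-const : ∀ d .{{_ : NonZero d}} q →
                    twoOver d *ℚ sum {d} (λ _ → q) ≡ q +ℚ q
twoOver-sum-const (suc d) q = begin
  (+ 2 / suc d) *ℚ sum {suc d} (λ _ → q)   ≡⟨ cong ((+ 2 / suc d) *ℚ_) (sum-const (suc d) q) ⟩
  (+ 2 / suc d) *ℚ ((+ suc d / 1) *ℚ q)    ≡⟨ ℚ.*-assoc (+ 2 / suc d) _ _ ⟨
  ((+ 2 / suc d) *ℚ (+ suc d / 1)) *ℚ q
    ≡⟨ cong (_*ℚ q) (fromℚᵘ-homo-* (mkℚᵘ (+ 2) d) (mkℚᵘ (+ suc d) 0)) ⟨
  fromℚᵘ (mkℚᵘ (+ 2) d ℚᵘ.* mkℚᵘ (+ suc d) 0) *ℚ q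
    ≡⟨ cong (_*ℚ q) (ℚ.fromℚᵘ-cong
         {mkℚᵘ (+ 2) d ℚᵘ.* mkℚᵘ (+ suc d) 0} {mkℚᵘ (+ 2) 0}
         (*≡* (cong +_ (trans (ℕ.*-identityʳ (2 * suc d))
                              (cong (2 *_) (sym (ℕ.*-identityʳ (suc d)))))))) ⟩
  (1ℚ +ℚ 1ℚ) *ℚ q                          ≡⟨ ℚ.*-distribʳ-+ q 1ℚ 1ℚ ⟩
  1ℚ *ℚ q +ℚ 1ℚ *ℚ q                       ≡⟨ cong₂ _+ℚ_ (ℚ.*-identityˡ q) (ℚ.*-identityˡ q) ⟩
  q +ℚ q                                   ∎
  where open ≡-Reasoning

-- The Grover step at a single vertex

δ-≡ : ∀ G {A : Set} (_≟_ : DecidableEquality A) {x y} → x ≡ y → δ G _≟_ x y ≡ 1ℚ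
δ-≡ G _≟_ {x} {y} eq = cong (λ b → if b then 1ℚ else 0ℚ) (dec-true (x ≟ y) eq)

δ-≢ : ∀ G {A : Set} (_≟_ : DecidableEquality A) {x y} → x ≢ y → δ G _≟_ x y ≡ 0ℚ
δ-≢ G _≟_ {x} {y} neq = cong (λ b → if b then 1ℚ else 0ℚ) (dec-false (x ≟ y) neq)

module GroverWalk (G : Graph) where
  open Graph G

  arc-≡ : ∀ {x y x′ y′} .{p : x ~ y} .{q : x′ ~ y′} →
          x ≡ x′ → y ≡ y′ → arc x y p ≡ arc x′ y′ q
  arc-≡ refl refl = refl

  -- A repetition-free list of the neighbours of `x`; it turns the sums over all vertices in
  -- `degree` and `sumArc` into sums over `Fin d`.
  record Neighbourhood (x : V) (d : ℕ) : Set where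
    field
      neighbour : Fin d → V
      edge      : ∀ k → neighbour k ~ x
      injective : Injective _≡_ _≡_ neighbour
      complete  : ∀ {y} → y ~ x → ∃[ k ] neighbour k ≡ y

    into : Fin d → Arc
    into k = arc (neighbour k) x (edge k)

    index : Fin d → Fin order
    index k = Inverse.from enumeration (neighbour k)

    vertex-index : ∀ k → vertex (index k) ≡ neighbour k
    vertex-index k = Inverse.strictlyInverseˡ enumeration (neighbour k)

    index-injective : Injective _≡_ _≡_ index
    index-injective {k} {l} eq = injective
      (trans (sym (vertex-index k)) (trans (cong vertex eq) (vertex-index l)))

    index-complete : ∀ {i} → vertex i ~ x → ∃[ k ] index k ≡ i
    index-complete {i} i~x with complete i~x
    ... | k , eq = k , trans (cong (Inverse.from enumeration) eq)
                             (Inverse.strictlyInverseʳ enumeration i)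

    degree-≡ : degree x ≡ d
    degree-≡ = begin
      degree x                     ≡⟨ ℕ-Sum.sum-reindex index index-injective indicator outside ⟩
      ℕ-Sum.sum (indicator ∘ index) ≡⟨ ℕ-Sum.sum-cong-≗ inside ⟩
      ℕ-Sum.sum {d} (λ _ → 1)      ≡⟨ count d ⟩
      d                            ∎
      where
      open ≡-Reasoning
      indicator : Fin order → ℕ
      indicator i = if does (x ~? vertex i) then 1 else 0

      outside : ∀ i → (∀ k → index k ≢ i) → indicator i ≡ 0
      outside i none = cong (λ b → if b then 1 else 0) (dec-false (x ~? vertex i) x≁i)
        where
        x≁i : ¬ (x ~ vertex i)
        x≁i x~i with index-complete (~-sym x~i)
        ... | k , eq = none k eq

      inside : ∀ k → indicator (index k) ≡ 1
      inside k = cong (λ b → if b then 1 else 0) (dec-true (x ~? vertex (index k))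
        (~-sym (subst (_~ x) (sym (vertex-index k)) (edge k))))

      count : ∀ n → ℕ-Sum.sum {n} (λ _ → 1) ≡ n
      count zero    = refl
      count (suc n) = cong suc (count n)

    valueIfArc-yes : ∀ g {y z} (p : y ~ z) D → valueIfArc G g y z D ≡ g (arc y z p)
    valueIfArc-yes g p (yes _) = refl
    valueIfArc-yes g p (no ¬p) = contradiction p ¬p

    -- In each row of the double sum only the column of `x` survives; the remaining single sum is
    -- supported on the neighbours of `x` and is reindexed by them.
    sumArc-into : (g : Arc → ℚ) → (∀ c → terminus c ≢ x → g c ≡ 0ℚ) →
                  sumArc G g ≡ sum (g ∘ into)
    sumArc-into g g≡0 = begin
      sumArc G g                       ≡⟨ ℚ-Sum.sum-cong-≗ row ⟩
      sum (λ i → value i ix)           ≡⟨ ℚ-Sum.sum-reindex index index-injective _ outside ⟩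
      sum (λ k → value (index k) ix)   ≡⟨ ℚ-Sum.sum-cong-≗ inside ⟩
      sum (g ∘ into)                   ∎
      where
      open ≡-Reasoning
      ix : Fin order
      ix = Inverse.from enumeration x

      vertex-ix : vertex ix ≡ x
      vertex-ix = Inverse.strictlyInverseˡ enumeration x

      value : Fin order → Fin order → ℚ
      value i j = valueIfArc G g (vertex i) (vertex j) (vertex i ~? vertex j)

      value-other : ∀ {y z} D → z ≢ x → valueIfArc G g y z D ≡ 0ℚ
      value-other (yes p) z≢x = g≡0 _ z≢x
      value-other (no _)  _   = refl

      row : ∀ i → sum (value i) ≡ value i ix
      row i = ℚ-Sum.sum-single ix λ j j≢ix → value-other (vertex i ~? vertex j) λ eq →
        j≢ix (trans (sym (Inverse.strictlyInverseʳ enumeration j))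
                    (cong (Inverse.from enumeration) eq))

      value-no : ∀ {y z} D → ¬ (y ~ z) → valueIfArc G g y z D ≡ 0ℚ
      value-no (yes p) ¬p = contradiction p ¬p
      value-no (no _)  _  = refl

      outside : ∀ i → (∀ k → index k ≢ i) → value i ix ≡ 0ℚ
      outside i none = value-no (vertex i ~? vertex ix) i≁x
        where
        i≁x : ¬ (vertex i ~ vertex ix)
        i≁x i~x with index-complete (subst (vertex i ~_) vertex-ix i~x)
        ... | k , eq = none k eq

      inside : ∀ k → value (index k) ix ≡ g (into k)
      inside k = trans
        (valueIfArc-yes g (subst (_~ vertex ix) (sym (vertex-index k))
          (subst (neighbour k ~_) (sym vertex-ix) (edge k))) (vertex (index k) ~? vertex ix))
        (cong g (arc-≡ (vertex-index k) vertex-ix))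

  -- On a column of `grover ^ k` this unfolds to the same column of `grover ^ suc k`, so powers can
  -- be followed one column at a time.
  step : (Arc → ℚ) → Arc → ℚ
  step f a = sumArc G λ c → grover G a c *ℚ f c

  step-cong : ∀ {f g : Arc → ℚ} → (∀ a → f a ≡ g a) → ∀ a → step f a ≡ step g a
  step-cong f≗g a =
    ℚ-Sum.sum-cong-≗ λ i → ℚ-Sum.sum-cong-≗ λ j → value-cong (vertex i ~? vertex j)
    where
    value-cong : ∀ {y z} D →
      valueIfArc G (λ c → grover G a c *ℚ _) y z D ≡ valueIfArc G (λ c → grover G a c *ℚ _) y z D
    value-cong (yes p) = cong (grover G a (arc _ _ p) *ℚ_) (f≗g (arc _ _ p))
    value-cong (no _)  = refl

  -- The row of `arc x y` vanishes outside the arcs into `x`. Each of these is transmitted with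
  -- weight 2/d, and only the inverse arc receives the extra -1.
  step-formula : ∀ {x y d} .{{_ : NonZero d}} (N : Neighbourhood x d) (p : x ~ y) f →
    let open Neighbourhood N in
    step f (arc x y p) ≡ twoOver d *ℚ sum (f ∘ into) -ℚ f (arc y x (~-sym p))
  step-formula {x} {y} {d} N p f = begin
    step f a                                      ≡⟨ sumArc-into _ outside ⟩
    sum (λ k → grover G a (into k) *ℚ f (into k)) ≡⟨ ℚ-Sum.sum-cong-≗ split ⟩
    sum (λ k → transmitted k +ℚ reflected k)      ≡⟨ ℚ-Sum.∑-distrib-+ transmitted reflected ⟩
    sum transmitted +ℚ sum reflected
      ≡⟨ cong₂ _+ℚ_ (sym (ℚ-Sum.*-distribˡ-sum (twoOver d) (f ∘ into))) sum-reflected ⟩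
    twoOver d *ℚ sum (f ∘ into) -ℚ f⁻  ∎
    where
    open Neighbourhood N
    open ≡-Reasoning
    a : Arc
    a = arc x y p

    f⁻ : ℚ
    f⁻ = f (arc y x (~-sym p))

    outside : ∀ c → terminus c ≢ x → grover G a c *ℚ f c ≡ 0ℚ
    outside c tc≢x = trans
      (cong (_*ℚ f c) (cong₂ (λ u v → u -ℚ v)
        (trans (cong (w *ℚ_) (δ-≢ G _≟_ (tc≢x ∘ sym))) (ℚ.*-zeroʳ w))
        (δ-≢ G _≟ᴬ_ {a} {c ⁻¹} λ eq → tc≢x (sym (cong origin eq)))))
      (ℚ.*-zeroˡ (f c))
      where
      w : ℚ
      w = (+ 2 / degree (terminus c)) {{terminus-degree-nonZero G c}}

    δᵃ : Fin d → ℚ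
    δᵃ k = δ G _≟ᴬ_ a (into k ⁻¹)

    transmitted reflected : Fin d → ℚ
    transmitted k = twoOver d *ℚ f (into k)
    reflected k = -ℚ (δᵃ k) *ℚ f (into k)

    split : ∀ k → grover G a (into k) *ℚ f (into k) ≡ transmitted k +ℚ reflected k
    split k = trans
      (cong (λ u → (u -ℚ δᵃ k) *ℚ f (into k))
        (trans (cong₂ _*ℚ_
                 (ℚ./-cong {+ 2} {q₁ = degree x} {q₂ = d}
                   {{terminus-degree-nonZero G (into k)}} refl degree-≡)
                 (δ-≡ G _≟_ refl))
               (ℚ.*-identityʳ (twoOver d))))
      (ℚ.*-distribʳ-+ (f (into k)) (twoOver d) (-ℚ (δᵃ k)))

    back : ∃[ k ] neighbour k ≡ y
    back = complete (~-sym p)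

    sum-reflected : sum reflected ≡ -ℚ f⁻
    sum-reflected = begin
      sum reflected  ≡⟨ ℚ-Sum.sum-single (proj₁ back) other ⟩
      reflected (proj₁ back)  ≡⟨ cong₂ (λ u c → -ℚ u *ℚ f c)
          (δ-≡ G _≟ᴬ_ {a} {into (proj₁ back) ⁻¹} (arc-≡ refl (sym (proj₂ back)))) (arc-≡ (proj₂ back) refl) ⟩
      -ℚ 1ℚ *ℚ f⁻  ≡⟨ ℚ.neg-distribˡ-* 1ℚ f⁻ ⟨
      -ℚ (1ℚ *ℚ f⁻)  ≡⟨ cong -ℚ_ (ℚ.*-identityˡ f⁻) ⟩
      -ℚ f⁻ ∎
      where
      other : ∀ k → k ≢ proj₁ back → reflected k ≡ 0ℚ
      other k k≢ = trans
        (cong (λ u → -ℚ u *ℚ f (into k)) (δ-≢ G _≟ᴬ_ {a} {into k ⁻¹} λ eq →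
          k≢ (injective (trans (sym (cong terminus eq)) (sym (proj₂ back))))))
        (ℚ.*-zeroˡ (f (into k)))

-- Directed strands and scattering at junctions

sum-neg : ∀ {n} (f : Fin n → ℚ) → sum (λ k → -ℚ (f k)) ≡ -ℚ (sum f)
sum-neg {zero}  f = refl
sum-neg {suc n} f = trans (cong (-ℚ (f zero) +ℚ_) (sum-neg (f ∘ suc)))
                          (sym (ℚ.neg-distrib-+ (f zero) (sum (f ∘ suc))))

Directed : ℕ → Set
Directed t = Fin t × Fin 2

rev : ∀ {t} → Directed t → Directed t
rev (i , s) = i , opposite s

rev-involutive : ∀ {t} (κ : Directed t) → rev (rev κ) ≡ κ
rev-involutive (i , s) = cong (i ,_) (Fin.opposite-involutive s)

rev-≢ : ∀ {t} (κ : Directed t) → rev κ ≢ κ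
rev-≢ (i , 0F) ()
rev-≢ (i , 1F) ()

-- G consists of t strands of 1 + m edges each; they may meet only in their
-- end points, and `point i j` (junk for j > 1 + m) is the j-th vertex of strand i.
record Strands (G : Graph) : Set where
  open Graph G
  field
    t m : ℕ
    0<m : 0 < m

  L : ℕ
  L = suc m

  field
    point          : Fin t → ℕ → V
    point-edge     : ∀ i {j} → j < L → point i j ~ point i (suc j)
    point-cover    : ∀ {x y} → x ~ y → ∃[ i ] ∃[ j ] (j < L ×
                     ((x ≡ point i j × y ≡ point i (suc j)) ⊎
                      (y ≡ point i j × x ≡ point i (suc j))))
    point-interior : ∀ {i i′ j j′} → 0 < j → j < L →
                     point i j ≡ point i′ j′ → i ≡ i′ × j ≡ j′
    point-turn     : ∀ i {j} → suc j < L → point i j ≢ point i (suc (suc j))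

  K : Set
  K = Directed t

  pt : K → ℕ → V
  pt (i , 0F) j = point i j
  pt (i , 1F) j = point i (L ∸ j)

  private
    L∸j : ∀ {j} → j < L → L ∸ j ≡ suc (m ∸ j)
    L∸j (s≤s j≤m) = ℕ.+-∸-assoc 1 j≤m

  pt-rev : ∀ κ {j} → j ≤ L → pt (rev κ) (L ∸ j) ≡ pt κ j
  pt-rev (i , 0F) j≤L = cong (point i) (ℕ.m∸[m∸n]≡n j≤L)
  pt-rev (i , 1F) j≤L = refl

  pt-edge : ∀ κ {j} → j < L → pt κ j ~ pt κ (suc j)
  pt-edge (i , 0F) j<L = point-edge i j<L
  pt-edge (i , 1F) {j} j<L = subst (λ u → point i u ~ point i (m ∸ j)) (sym (L∸j j<L))
    (~-sym (point-edge i (s≤s (ℕ.m∸n≤m m j))))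

  pt-cover : ∀ {x y} → x ~ y →
             ∃[ κ ] ∃[ j ] (j < L × x ≡ pt κ j × y ≡ pt κ (suc j))
  pt-cover x~y with point-cover x~y
  ... | i , j , j<L , inj₁ (x≡ , y≡) = (i , 0F) , j , j<L , x≡ , y≡
  -- Edge `j` of the strand is edge `m ∸ j` when the strand is read backwards.
  ... | i , j , j<L@(s≤s j≤m) , inj₂ (y≡ , x≡) =
    (i , 1F) , m ∸ j , s≤s (ℕ.m∸n≤m m j) ,
    trans x≡ (cong (point i) (sym (ℕ.m∸[m∸n]≡n j<L))) ,
    trans y≡ (cong (point i) (sym (ℕ.m∸[m∸n]≡n j≤m)))

  -- An interior vertex lies on one strand only, but that strand carries two directions, hence the
  -- two alternatives.
  pt-interior : ∀ κ κ′ {j j′} → 0 < j → j < L → j′ ≤ L → pt κ j ≡ pt κ′ j′ →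
                (κ ≡ κ′ × j ≡ j′) ⊎ (κ′ ≡ rev κ × j′ ≡ L ∸ j)
  pt-interior (i , 0F) (i′ , 0F) 0<j j<L j′≤L eq with point-interior 0<j j<L eq
  ... | refl , refl = inj₁ (refl , refl)
  pt-interior (i , 0F) (i′ , 1F) 0<j j<L j′≤L eq with point-interior 0<j j<L eq
  ... | refl , refl = inj₂ (refl , sym (ℕ.m∸[m∸n]≡n j′≤L))
  pt-interior (i , 1F) (i′ , 0F) {suc j} 0<j (s≤s j<m) j′≤L eq
    with point-interior (ℕ.m<n⇒0<n∸m j<m) (s≤s (ℕ.m∸n≤m m j)) eq
  ... | refl , refl = inj₂ (refl , refl)
  pt-interior (i , 1F) (i′ , 1F) {suc j} 0<j (s≤s j<m) j′≤L eq
    with point-interior (ℕ.m<n⇒0<n∸m j<m) (s≤s (ℕ.m∸n≤m m j)) eq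
  ... | refl , j≡ = inj₁ (refl , ℕ.∸-cancelˡ-≡ (ℕ.m≤n⇒m≤1+n j<m) j′≤L j≡)

  pt-turn : ∀ κ {j} → suc j < L → pt κ j ≢ pt κ (suc (suc j))
  pt-turn (i , 0F) j+1<L eq = point-turn i j+1<L eq
  pt-turn (i , 1F) {j} (s≤s j<m) eq = point-turn i {m ∸ suc j}
    (s≤s (subst (_≤ m) (ℕ.+-∸-assoc 1 j<m) (ℕ.m∸n≤m m j)))
    (sym (trans (cong (point i) (sym (trans (L∸j (ℕ.m<n⇒m<1+n j<m))
                                            (cong suc (ℕ.+-∸-assoc 1 j<m))))) eq))

  pt-end : ∀ κ κ′ {j} → j < L → pt κ j ≡ pt κ′ 0 → j ≡ 0
  pt-end κ κ′ {zero}  _   _  = refl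
  pt-end κ κ′ {suc j} j<L eq with pt-interior κ κ′ ℕ.z<s j<L ℕ.z≤n eq
  ... | inj₂ (_ , 0≡L∸j) = contradiction 0≡L∸j (ℕ.<⇒≢ (ℕ.m<n⇒0<n∸m j<L))

-- `inc κ` lists the d directed strands that arrive at the vertex which κ leaves.
-- The laws inc-inc and inc-rev, which say that reversal commutes with averaging
-- at the junctions, are what makes `scatter` an involution.
record Junctions {G : Graph} (S : Strands G) : Set where
  open Strands S
  field
    d            : ℕ
    ⦃ d-nonZero ⦄ : NonZero d
    inc          : K → Fin d → K
    inc-inj      : ∀ κ → Injective _≡_ _≡_ (inc κ)
    inc-end      : ∀ κ k → pt (inc κ k) L ≡ pt κ 0
    inc-complete : ∀ κ κ′ → pt κ′ L ≡ pt κ 0 → ∃[ k ] inc κ k ≡ κ′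
    inc-inc      : ∀ κ k l → inc (inc κ k) l ≡ inc (rev κ) l
    inc-rev      : ∀ κ (f : K → ℚ) → sum (f ∘ rev ∘ inc κ) ≡ sum (f ∘ inc (rev κ))

  -- The Grover step at a junction: `f` gives the amplitudes on the last arcs of the directed
  -- strands, the result those on the first arcs. The last arc of `rev κ` is the inverse of the
  -- first arc of `κ`, which accounts for the reflected term.
  scatter : (K → ℚ) → K → ℚ
  scatter f κ = twoOver d *ℚ sum (f ∘ inc κ) -ℚ f (rev κ)

  field
    start         : K
    scatter-start : (f : K → ℚ) → f start ≡ 1ℚ → (∀ κ → κ ≢ start → f κ ≡ 0ℚ) →
                    ¬ (∀ κ → scatter f κ ≡ f κ)

  scatter-cong : ∀ {f g : K → ℚ} → (∀ κ → f κ ≡ g κ) → ∀ κ → scatter f κ ≡ scatter g κ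
  scatter-cong f≗g κ = cong₂ (λ u v → twoOver d *ℚ u -ℚ v)
    (ℚ-Sum.sum-cong-≗ (f≗g ∘ inc κ)) (f≗g (rev κ))

  -- The same sum `A` occurs everywhere: `inc-inc` makes it the coin sum of every `inc κ k`, and
  -- `inc-rev` makes it the sum of the reflected terms. As averaging fixes the constant `c *ℚ A`,
  -- what remains is 2cA - cA - (cA - f κ).
  scatter-involutive : ∀ f κ → scatter (scatter f) κ ≡ f κ
  scatter-involutive f κ = begin
    c *ℚ sum (scatter f ∘ inc κ) -ℚ scatter f (rev κ)
      ≡⟨ cong₂ (λ u v → c *ℚ u -ℚ (c *ℚ A -ℚ v)) inner (cong f (rev-involutive κ)) ⟩
    c *ℚ (sum {d} (λ _ → c *ℚ A) +ℚ -ℚ A) -ℚ (c *ℚ A -ℚ f κ)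
      ≡⟨ cong (_-ℚ (c *ℚ A -ℚ f κ)) (ℚ.*-distribˡ-+ c _ _) ⟩
    c *ℚ sum {d} (λ _ → c *ℚ A) +ℚ c *ℚ -ℚ A -ℚ (c *ℚ A -ℚ f κ)
      ≡⟨ cong₂ (λ u v → u +ℚ v -ℚ (c *ℚ A -ℚ f κ))
           (twoOver-sum-const d (c *ℚ A)) (sym (ℚ.neg-distribʳ-* c A)) ⟩
    (c *ℚ A +ℚ c *ℚ A -ℚ c *ℚ A) -ℚ (c *ℚ A -ℚ f κ)
      ≡⟨ solve 2 (λ b y → (b :+ b :- b) :- (b :- y) := y) refl (c *ℚ A) (f κ) ⟩
    f κ ∎
    where
    open ≡-Reasoning
    open +-*-Solver
    c A : ℚ
    c = twoOver d
    A = sum (f ∘ inc (rev κ))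

    inner : sum (scatter f ∘ inc κ) ≡ sum {d} (λ _ → c *ℚ A) +ℚ -ℚ A
    inner = begin
      sum (scatter f ∘ inc κ)
        ≡⟨ ℚ-Sum.sum-cong-≗ (λ k → cong (λ u → c *ℚ u -ℚ f (rev (inc κ k)))
             (ℚ-Sum.sum-cong-≗ (cong f ∘ inc-inc κ k))) ⟩
      sum (λ k → c *ℚ A -ℚ f (rev (inc κ k)))
        ≡⟨ ℚ-Sum.∑-distrib-+ (λ _ → c *ℚ A) (λ k → -ℚ (f (rev (inc κ k)))) ⟩
      sum {d} (λ _ → c *ℚ A) +ℚ sum (λ k → -ℚ (f (rev (inc κ k))))
        ≡⟨ cong (sum {d} (λ _ → c *ℚ A) +ℚ_)
             (trans (sum-neg (f ∘ rev ∘ inc κ)) (cong -ℚ_ (inc-rev κ f))) ⟩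
      sum {d} (λ _ → c *ℚ A) +ℚ -ℚ A ∎

-- Evolution along the strands and the exact period

module Evolution {G : Graph} (S : Strands G) (J : Junctions S) where
  open Graph G
  open GroverWalk G
  open Strands S
  open Junctions J

  seg : ∀ κ j → j < L → Arc
  seg κ j j<L = arc (pt κ j) (pt κ (suc j)) (pt-edge κ j<L)

  seg-cong : ∀ κ {j j′} p q → j ≡ j′ → seg κ j p ≡ seg κ j′ q
  seg-cong κ p q refl = refl

  seg-surjective : ∀ a → ∃[ κ ] ∃[ j ] ∃[ p ] a ≡ seg κ j p
  seg-surjective (arc x y p) with pt-cover (recompute (x ~? y) p)
  ... | κ , j , j<L , x≡ , y≡ = κ , j , j<L , arc-≡ x≡ y≡

  m<L : m < L
  m<L = ℕ.n<1+n m

  0<L : 0 < L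
  0<L = ℕ.z<s

  1<L : 1 < L
  1<L = s≤s 0<m

  interior-neighbourhood : ∀ κ {j} → suc j < L → Neighbourhood (pt κ (suc j)) 2
  interior-neighbourhood κ {j} j+1<L = record
    { neighbour = λ { 0F → pt κ j ; 1F → pt κ (suc (suc j)) }
    ; edge      = λ { 0F → pt-edge κ (ℕ.<⇒≤ j+1<L) ; 1F → ~-sym (pt-edge κ j+1<L) }
    ; injective = λ { {0F} {0F} _ → refl ; {1F} {1F} _ → refl
                    ; {0F} {1F} eq → contradiction eq (pt-turn κ j+1<L)
                    ; {1F} {0F} eq → contradiction (sym eq) (pt-turn κ j+1<L) }
    ; complete  = λ y~x → find y~x
    }
    where
    find : ∀ {y} → y ~ pt κ (suc j) → ∃[ k ] _ ≡ y
    find y~x with pt-cover y~x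
    ... | κ′ , j′ , j′<L , y≡ , x≡ with pt-interior κ κ′ ℕ.z<s j+1<L j′<L x≡
    -- An edge that enters the vertex along `κ` comes from the previous point; one that enters along
    -- `rev κ` comes from the next point of `κ`.
    ...   | inj₁ (refl , eq) = 0F , sym (trans y≡ (cong (pt κ) (sym (ℕ.suc-injective eq))))
    ...   | inj₂ (refl , eq) = 1F , trans (sym (pt-rev κ j+1<L))
              (trans (cong (pt (rev κ)) (trans (sym (ℕ.pred[m∸n]≡m∸[1+n] m j))
                                               (cong ℕ.pred (sym eq)))) (sym y≡))

  junction-neighbourhood : ∀ κ → Neighbourhood (pt κ 0) d
  junction-neighbourhood κ = record
    { neighbour = λ k → pt (inc κ k) m
    ; edge      = λ k → subst (pt (inc κ k) m ~_) (inc-end κ k) (pt-edge (inc κ k) m<L)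
    ; injective = inj
    ; complete  = find
    }
    where
    inj : Injective _≡_ _≡_ (λ k → pt (inc κ k) m)
    inj {k} {l} eq with pt-interior (inc κ k) (inc κ l) 0<m m<L (ℕ.<⇒≤ m<L) eq
    ... | inj₁ (eq′ , _) = inc-inj κ eq′
    -- Here the two strands are reverse to each other and `m` is 1. As both arrive at the same
    -- junction, the strand would be closed with two edges, which `pt-turn` forbids.
    ... | inj₂ (l≡rev , m≡) = contradiction closed (pt-turn (inc κ k) 1<L)
      where
      L≡2 : L ≡ 2
      L≡2 = cong suc (trans m≡ (ℕ.m+n∸n≡m 1 m))

      closed : pt (inc κ k) 0 ≡ pt (inc κ k) 2
      closed = begin
        pt (inc κ k) 0           ≡⟨ pt-rev (inc κ k) ℕ.z≤n ⟨
        pt (rev (inc κ k)) L     ≡⟨ cong (λ κ′ → pt κ′ L) l≡rev ⟨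
        pt (inc κ l) L           ≡⟨ inc-end κ l ⟩
        pt κ 0                   ≡⟨ inc-end κ k ⟨
        pt (inc κ k) L           ≡⟨ cong (pt (inc κ k)) L≡2 ⟩
        pt (inc κ k) 2           ∎
        where open ≡-Reasoning

    find : ∀ {y} → y ~ pt κ 0 → ∃[ k ] pt (inc κ k) m ≡ y
    find y~x with pt-cover y~x
    ... | κ′ , j , j<L , y≡ , x≡ with ℕ.m≤n⇒m<n∨m≡n j<L
    ...   | inj₁ j+1<L = contradiction (pt-end κ′ κ j+1<L (sym x≡)) λ ()
    ...   | inj₂ refl with inc-complete κ κ′ (sym x≡)
    ...     | k , refl = k , sym y≡

  -- In degree 2 the weight `twoOver 2` evaluates to `1ℚ`, so the amplitude on the inverse arc
  -- cancels and nothing is reflected.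
  step-interior : ∀ f κ j (p : suc j < L) →
                  step f (seg κ (suc j) p) ≡ f (seg κ j (ℕ.<⇒≤ p))
  step-interior f κ j p = trans
    (step-formula (interior-neighbourhood κ p) (pt-edge κ p) f)
    (solve 2 (λ u v → con 1ℚ :* (u :+ (v :+ con 0ℚ)) :- v := u) refl
       (f (seg κ j (ℕ.<⇒≤ p))) _)
    where open +-*-Solver

  step-junction : ∀ f κ →
    step f (seg κ 0 0<L) ≡ scatter (λ κ′ → f (seg κ′ m m<L)) κ
  step-junction f κ = trans
    (step-formula (junction-neighbourhood κ) (pt-edge κ 0<L) f)
    (cong₂ (λ u v → twoOver d *ℚ u -ℚ v)
      (ℚ-Sum.sum-cong-≗ λ k → cong f (arc-≡ refl (sym (inc-end κ k))))
      (cong f (arc-≡ (sym (pt-rev κ 1≤L)) (sym (pt-rev κ ℕ.z≤n)))))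
    where
    1≤L : 1 ≤ L
    1≤L = ℕ.z<s

  module _ (b : Arc) where

    F : ℕ → Arc → ℚ
    F k a = _^_ G (grover G) k a b

    -- The arcs at positions `suc j` to `i + j` all start at interior vertices, so each of the `i`
    -- steps is a pure transmission.
    advance : ∀ κ i {j} k (p : i + j < L) →
              F (i + k) (seg κ (i + j) p) ≡ F k (seg κ j (ℕ.≤-<-trans (ℕ.m≤n+m j i) p))
    advance κ zero    k p = refl
    advance κ (suc i) k p =
      trans (step-interior (F (i + k)) κ _ p) (advance κ i k (ℕ.<⇒≤ p))

    -- Traced back from position `j`, the time `L` consists of `j` transmissions down to the first
    -- arc, one scattering, and `m ∸ j` transmissions from the last arcs of the arriving strands
    -- back to position `j`. Thus every layer is mapped to itself by `scatter`.
    traverse : ∀ k κ {j} (p : j < L) →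
               F (L + k) (seg κ j p) ≡ scatter (λ κ′ → F k (seg κ′ j p)) κ
    traverse k κ {j} p@(s≤s j≤m) = begin
      F (L + k) (seg κ j p)
        ≡⟨ cong₂ F L+k≡ (seg-cong κ p j+0<L (sym (ℕ.+-identityʳ j))) ⟩
      F (j + suc (r + k)) (seg κ (j + 0) j+0<L)
        ≡⟨ advance κ j (suc (r + k)) j+0<L ⟩
      F (suc (r + k)) (seg κ 0 0<L)
        ≡⟨ step-junction (F (r + k)) κ ⟩
      scatter (λ κ′ → F (r + k) (seg κ′ m m<L)) κ
        ≡⟨ scatter-cong (λ κ′ → trans (cong (F (r + k)) (seg-cong κ′ m<L r+j<L (sym r+j≡m)))
                                      (advance κ′ r k r+j<L)) κ ⟩
      scatter (λ κ′ → F k (seg κ′ j p)) κ ∎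
      where
      open ≡-Reasoning
      r : ℕ
      r = m ∸ j

      r+j≡m : r + j ≡ m
      r+j≡m = ℕ.m∸n+n≡m j≤m

      j+0<L : j + 0 < L
      j+0<L = subst (_< L) (sym (ℕ.+-identityʳ j)) p

      r+j<L : r + j < L
      r+j<L = subst (_< L) (sym r+j≡m) m<L

      L+k≡ : L + k ≡ j + suc (r + k)
      L+k≡ = begin
        suc (m + k)        ≡⟨ cong (λ u → suc (u + k)) (ℕ.m+[n∸m]≡n j≤m) ⟨
        suc (j + r + k)    ≡⟨ cong suc (ℕ.+-assoc j r k) ⟩
        suc (j + (r + k))  ≡⟨ ℕ.+-suc j (r + k) ⟨
        j + suc (r + k)    ∎

    double-traverse : ∀ a → F (2 * L) a ≡ F 0 a
    double-traverse a with seg-surjective a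
    ... | κ , j , p , refl = begin
      F (L + (L + 0)) (seg κ j p)  ≡⟨ traverse (L + 0) κ p ⟩
      scatter (λ κ′ → F (L + 0) (seg κ′ j p)) κ  ≡⟨ scatter-cong (λ κ′ → traverse 0 κ′ p) κ ⟩
      scatter (scatter (λ κ′ → F 0 (seg κ′ j p))) κ  ≡⟨ scatter-involutive (λ κ′ → F 0 (seg κ′ j p)) κ ⟩
      F 0 (seg κ j p)  ∎
      where open ≡-Reasoning

    -- Powers act on a column from the left, so once the column has returned at time `σ` its whole
    -- later evolution repeats.
    F-shift : ∀ {σ} → (∀ a → F σ a ≡ F 0 a) → ∀ k a → F (k + σ) a ≡ F k a
    F-shift eq zero    = eq
    F-shift eq (suc k) = step-cong (F-shift eq k)

  b₀ : Arc
  b₀ = seg start 0 0<L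

  F-b₀ : F b₀ 0 b₀ ≡ 1ℚ
  F-b₀ = δ-≡ G _≟ᴬ_ {b₀} refl

  F-seg≢b₀ : ∀ κ {j} p → seg κ j p ≢ b₀ → F b₀ 0 (seg κ j p) ≡ 0ℚ
  F-seg≢b₀ κ p = δ-≢ G _≟ᴬ_

  -- After `σ` steps the unit amplitude placed on `b₀` has reached position `σ` of the same strand.
  -- That arc differs from `b₀`, because its origin is not an end of the strand.
  not-before-L : ∀ {σ} → 0 < σ → σ < L → ¬ (∀ a → F b₀ σ a ≡ F b₀ 0 a)
  not-before-L {σ} 0<σ σ<L eq = contradiction 1≡0 λ ()
    where
    open ≡-Reasoning
    σ+0<L : σ + 0 < L
    σ+0<L = subst (_< L) (sym (ℕ.+-identityʳ σ)) σ<L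

    moved : seg start (σ + 0) σ+0<L ≢ b₀
    moved eq′ = ℕ.<⇒≢ 0<σ (sym (trans (sym (ℕ.+-identityʳ σ))
      (pt-end start start σ+0<L (cong origin eq′))))

    1≡0 : 1ℚ ≡ 0ℚ
    1≡0 = begin
      1ℚ                                      ≡⟨ F-b₀ ⟨
      F b₀ 0 b₀                               ≡⟨ advance b₀ start σ 0 σ+0<L ⟨
      F b₀ (σ + 0) (seg start (σ + 0) σ+0<L)
        ≡⟨ cong (λ k → F b₀ k (seg start (σ + 0) σ+0<L)) (ℕ.+-identityʳ σ) ⟩
      F b₀ σ (seg start (σ + 0) σ+0<L)  ≡⟨ eq _ ⟩
      F b₀ 0 (seg start (σ + 0) σ+0<L)        ≡⟨ F-seg≢b₀ start σ+0<L moved ⟩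
      0ℚ                                      ∎

  seg-0-injective : ∀ κ κ′ → seg κ 0 0<L ≡ seg κ′ 0 0<L → κ ≡ κ′
  seg-0-injective κ κ′ eq
    with pt-interior κ κ′ ℕ.z<s 1<L (ℕ.<⇒≤ 1<L) (cong terminus eq)
  ... | inj₁ (κ≡κ′ , _) = κ≡κ′
  -- Again this would be a closed strand of two edges.
  ... | inj₂ (refl , 1≡m) = contradiction closed (pt-turn κ 1<L)
    where
    open ≡-Reasoning
    closed : pt κ 0 ≡ pt κ 2
    closed = begin
      pt κ 0              ≡⟨ cong origin eq ⟩
      pt (rev κ) 0        ≡⟨ cong (pt (rev κ)) (ℕ.n∸n≡0 L) ⟨
      pt (rev κ) (L ∸ L)  ≡⟨ pt-rev κ ℕ.≤-refl ⟩
      pt κ L              ≡⟨ cong (pt κ ∘ suc) 1≡m ⟨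
      pt κ 2              ∎

  -- On layer 0 the column of `b₀` is the indicator of `start`. By `traverse`, a return at time `L`
  -- would make it a fixed point of `scatter`.
  not-L : ¬ (∀ a → F b₀ L a ≡ F b₀ 0 a)
  not-L eq = scatter-start (λ κ → F b₀ 0 (seg κ 0 0<L)) F-b₀
    (λ κ κ≢ → F-seg≢b₀ κ 0<L (κ≢ ∘ seg-0-injective κ start))
    λ κ → begin
      scatter (λ κ′ → F b₀ 0 (seg κ′ 0 0<L)) κ  ≡⟨ traverse b₀ 0 κ 0<L ⟨
      F b₀ (L + 0) (seg κ 0 0<L)  ≡⟨ cong (λ k → F b₀ k (seg κ 0 0<L)) (ℕ.+-identityʳ L) ⟩
      F b₀ L (seg κ 0 0<L)        ≡⟨ eq (seg κ 0 0<L) ⟩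
      F b₀ 0 (seg κ 0 0<L)        ∎
    where open ≡-Reasoning

  minimal : ∀ {σ} → 0 < σ → (∀ a → F b₀ σ a ≡ F b₀ 0 a) → 2 * L ≤ σ
  minimal {σ} 0<σ eq with 2 * L ℕ.≤? σ | ℕ.<-cmp σ L
  ... | yes 2L≤σ | _ = 2L≤σ
  ... | no  _    | tri< σ<L _ _ = contradiction eq (not-before-L 0<σ σ<L)
  ... | no  _    | tri≈ _ refl _ = contradiction eq not-L
  ... | no  2L≰σ | tri> _ _ L<σ =
    contradiction complement (not-before-L (ℕ.m<n⇒0<n∸m σ<2L) k<L)
    where
    open ≡-Reasoning
    σ<2L : σ < 2 * L
    σ<2L = ℕ.≰⇒> 2L≰σ

    k<L : 2 * L ∸ σ < L
    k<L = subst (2 * L ∸ σ <_) (trans (ℕ.m+n∸m≡n L (L + 0)) (ℕ.+-identityʳ L))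
      (ℕ.∸-monoʳ-< L<σ (ℕ.<⇒≤ σ<2L))

    complement : ∀ a → F b₀ (2 * L ∸ σ) a ≡ F b₀ 0 a
    complement a = begin
      F b₀ (2 * L ∸ σ) a      ≡⟨ F-shift b₀ eq (2 * L ∸ σ) a ⟨
      F b₀ (2 * L ∸ σ + σ) a  ≡⟨ cong (λ k → F b₀ k a) (ℕ.m∸n+n≡m (ℕ.<⇒≤ σ<2L)) ⟩
      F b₀ (2 * L) a          ≡⟨ double-traverse b₀ a ⟩
      F b₀ 0 a                ∎

  periodic : IsPeriodic G (2 * L)
  periodic = ℕ.z<s , (λ a b → double-traverse b a) ,
             λ σ 0<σ eq → minimal 0<σ λ a → eq a b₀

-- Strands with ends `e₀` and `e₁`, possibly equal

module Strand {E : Set} (e₀ e₁ : E) (t m : ℕ) where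

  -- The far end of edge `j`. Edge `m` is the last one; larger indices also give `e₁`, as a junk
  -- value.
  afterEdge : Fin t → (j : ℕ) → Dec (j < m) → E ⊎ (Fin t × Fin m)
  afterEdge i j (yes j<m) = inj₂ (i , fromℕ< j<m)
  afterEdge i j (no  _)   = inj₁ e₁

  strand : Fin t → ℕ → E ⊎ (Fin t × Fin m)
  strand i zero    = inj₁ e₀
  strand i (suc j) = afterEdge i j (j ℕ.<? m)

  strand-inner : ∀ i {j} (j<m : j < m) → strand i (suc j) ≡ inj₂ (i , fromℕ< j<m)
  strand-inner i {j} j<m with j ℕ.<? m
  ... | yes _   = refl
  ... | no j≮m  = contradiction j<m j≮m

  strand-last : ∀ i → strand i (suc m) ≡ inj₁ e₁
  strand-last i with m ℕ.<? m
  ... | yes m<m = contradiction m<m (ℕ.<-irrefl refl)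
  ... | no  _   = refl

  strand-toℕ : ∀ i (j : Fin m) → inj₂ (i , j) ≡ strand i (suc (toℕ j))
  strand-toℕ i j = sym (trans (strand-inner i (Fin.toℕ<n j))
    (cong (λ u → inj₂ (i , u)) (Fin.fromℕ<-toℕ j (Fin.toℕ<n j))))

  strand-interior : ∀ {i i′ j j′} → 0 < j → j < suc m →
                    strand i j ≡ strand i′ j′ → i ≡ i′ × j ≡ j′
  strand-interior {i} {j = suc j} {zero} _ (s≤s j<m) eq =
    contradiction (trans (sym (strand-inner i j<m)) eq) λ ()
  strand-interior {i} {i′} {suc j} {suc j′} _ (s≤s j<m) eq
    with j′ ℕ.<? m | trans (sym (strand-inner i j<m)) eq
  ... | yes j′<m | eq′ =
    let eq″ = Sum.inj₂-injective eq′ in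
    cong proj₁ eq″ ,
    cong suc (Fin.fromℕ<-injective j j′ j<m j′<m (cong proj₂ eq″))

  -- Only `j ≡ 0` is delicate: point 2 is interior if `1 < m`, and otherwise it is the end `e₁`,
  -- which then has to differ from `e₀`.
  strand-turn : e₀ ≢ e₁ ⊎ 1 < m → ∀ i {j} → suc j < suc m →
                strand i j ≢ strand i (suc (suc j))
  strand-turn proper i {suc j} j+1<L eq with strand-interior ℕ.z<s (ℕ.<⇒≤ j+1<L) eq
  ... | _ , ()
  strand-turn proper i {zero} _ eq with 1 ℕ.<? m
  strand-turn proper       i {zero} _ () | yes _
  strand-turn (inj₁ e₀≢e₁) i {zero} _ eq | no _ = e₀≢e₁ (Sum.inj₁-injective eq)
  strand-turn (inj₂ 1<m)   i {zero} _ eq | no 1≮m = 1≮m 1<m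

-- The Dutch windmill graph

module Windmill (t m : ℕ) (2≤t : 2 ≤ t) (3≤n : 3 ≤ suc m) where
  open Strand tt tt t m
  G : Graph
  G = windmill t (suc m) 3≤n
  open Graph G

  glue-strand : ∀ i (u : Fin (suc m)) → glue i u ≡ strand i (toℕ u)
  glue-strand i zero    = refl
  glue-strand i (suc j) = strand-toℕ i j

  -- This covers the closing edge of the cycle too, since vertex 0 reappears as the last point of
  -- the strand.
  glue-next : ∀ i {u v} → CycleNext (suc m) u v → glue i v ≡ strand i (suc (toℕ u))
  glue-next i {v = v} (inj₁ next) = trans (glue-strand i v) (cong (strand i) (sym next))
  glue-next i {v = zero} (inj₂ (last , _)) =
    sym (trans (cong (strand i) last) (strand-last i))

  edge : ∀ i {j} → j < suc m → strand i j ~ strand i (suc j)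
  edge i {j} j<L with ℕ.m≤n⇒m<n∨m≡n j<L
  ... | inj₁ j+1<L =
    i , fromℕ< j<L , fromℕ< j+1<L ,
    fwd (inj₁ (trans (cong suc (Fin.toℕ-fromℕ< j<L)) (sym (Fin.toℕ-fromℕ< j+1<L)))) ,
    trans (glue-strand i (fromℕ< j<L)) (cong (strand i) (Fin.toℕ-fromℕ< j<L)) ,
    trans (glue-strand i (fromℕ< j+1<L)) (cong (strand i) (Fin.toℕ-fromℕ< j+1<L))
  ... | inj₂ refl =
    i , fromℕ< j<L , zero , fwd (inj₂ (cong suc (Fin.toℕ-fromℕ< j<L) , refl)) ,
    trans (glue-strand i (fromℕ< j<L)) (cong (strand i) (Fin.toℕ-fromℕ< j<L)) ,
    sym (strand-last i)

  cover : ∀ {x y} → x ~ y → ∃[ i ] ∃[ j ] (j < suc m ×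
          ((x ≡ strand i j × y ≡ strand i (suc j)) ⊎
           (y ≡ strand i j × x ≡ strand i (suc j))))
  cover (i , u , v , fwd next , refl , refl) =
    i , toℕ u , Fin.toℕ<n u , inj₁ (glue-strand i u , glue-next i next)
  cover (i , u , v , bwd next , refl , refl) =
    i , toℕ v , Fin.toℕ<n v , inj₂ (glue-strand i v , glue-next i next)

  1<m : 1 < m
  1<m = ℕ.s≤s⁻¹ 3≤n

  strands : Strands G
  strands = record
    { t = t ; m = m ; 0<m = ℕ.<⇒≤ 1<m
    ; point = strand ; point-edge = edge ; point-cover = cover
    ; point-interior = strand-interior ; point-turn = strand-turn (inj₂ 1<m)
    }

  open Strands strands using (pt; L; K)

  pt-start : ∀ κ → pt κ 0 ≡ inj₁ tt
  pt-start (i , 0F) = refl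
  pt-start (i , 1F) = strand-last i

  pt-finish : ∀ κ → pt κ L ≡ inj₁ tt
  pt-finish (i , 0F) = strand-last i
  pt-finish (i , 1F) = cong (strand i) (ℕ.n∸n≡0 m)

  -- Every directed strand arrives at the common vertex, so this one enumeration serves as `inc κ`
  -- for all `κ`.
  directed : Fin (t * 2) → K
  directed = remQuot 2

  code : K → Fin (t * 2)
  code (i , s) = combine i s

  directed-code : ∀ κ → directed (code κ) ≡ κ
  directed-code (i , s) = Fin.remQuot-combine i s

  code-directed : ∀ k → code (directed k) ≡ k
  code-directed = Fin.combine-remQuot {t} 2

  directed-injective : Injective _≡_ _≡_ directed
  directed-injective {k} {l} eq =
    trans (sym (code-directed k)) (trans (cong code eq) (code-directed l))

  -- Reversal permutes the directed strands, so it only reorders the sum.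
  sum-rev : ∀ (f : K → ℚ) → sum (f ∘ rev ∘ directed) ≡ sum (f ∘ directed)
  sum-rev f = sym (trans
    (ℚ-Sum.sum-reindex reversed reversed-injective (f ∘ directed)
      (λ i none → contradiction (reversed-involutive i) (none (reversed i))))
    (ℚ-Sum.sum-cong-≗ λ k → cong f (directed-code (rev (directed k)))))
    where
    reversed : Fin (t * 2) → Fin (t * 2)
    reversed = code ∘ rev ∘ directed

    reversed-involutive : ∀ k → reversed (reversed k) ≡ k
    reversed-involutive k = trans
      (cong (code ∘ rev) (directed-code (rev (directed k))))
      (trans (cong code (rev-involutive (directed k))) (code-directed k))

    reversed-injective : Injective _≡_ _≡_ reversed
    reversed-injective {k} {l} eq =
      trans (sym (reversed-involutive k)) (trans (cong reversed eq) (reversed-involutive l))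

  -- The second strand is where `2 ≤ t` enters: with a single one the common vertex has degree 2 and
  -- `scatter` is the identity.
  strand₀ strand₁ : Fin t
  strand₀ = fromℕ< (ℕ.<⇒≤ 2≤t)
  strand₁ = fromℕ< 2≤t

  strand₁≢strand₀ : strand₁ ≢ strand₀
  strand₁≢strand₀ eq with Fin.fromℕ<-injective 1 0 2≤t (ℕ.<⇒≤ 2≤t) eq
  ... | ()

  junctions : Junctions strands
  junctions = record
    { d = t * 2
    ; d-nonZero = 2t≢0
    ; inc = λ _ → directed
    ; inc-inj = λ _ → directed-injective
    ; inc-end = λ κ k → trans (pt-finish (directed k)) (sym (pt-start κ))
    ; inc-complete = λ _ κ′ _ → code κ′ , directed-code κ′
    ; inc-inc = λ _ _ _ → refl
    ; inc-rev = λ _ → sum-rev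
    ; start = strand₀ , 0F
    ; scatter-start = λ f → no-fixed (twoOver (t * 2) *ℚ sum (f ∘ directed)) f
    }
    where
    instance
      2t≢0 : NonZero (t * 2)
      2t≢0 = ℕ.m*n≢0 t 2 ⦃ ℕ.>-nonZero (ℕ.<⇒≤ 2≤t) ⦄

    -- At all directed strands the scattered value is the same average minus
    -- the value at the reverse; the two strands below disagree on that average.
    no-fixed : ∀ q (f : K → ℚ) → f (strand₀ , 0F) ≡ 1ℚ →
               (∀ κ → κ ≢ (strand₀ , 0F) → f κ ≡ 0ℚ) →
               ¬ (∀ κ → q -ℚ f (rev κ) ≡ f κ)
    no-fixed q f f≡1 f≡0 fixed = contradiction 1≡0 λ ()
      where
      open ≡-Reasoning
      f-other : ∀ s → f (strand₁ , s) ≡ 0ℚ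
      f-other s = f≡0 (strand₁ , s) (strand₁≢strand₀ ∘ cong proj₁)

      1≡0 : 1ℚ ≡ 0ℚ
      1≡0 = begin
        1ℚ                            ≡⟨ f≡1 ⟨
        f (strand₀ , 0F)              ≡⟨ fixed (strand₀ , 0F) ⟨
        q -ℚ f (strand₀ , 1F)         ≡⟨ cong (λ u → q -ℚ u)
                                            (trans (f≡0 (strand₀ , 1F) λ ()) (sym (f-other 1F))) ⟩
        q -ℚ f (strand₁ , 1F)         ≡⟨ fixed (strand₁ , 0F) ⟩
        f (strand₁ , 0F)              ≡⟨ f-other 0F ⟩
        0ℚ                            ∎

  periodic : IsPeriodic G (2 * suc m)
  periodic = Evolution.periodic strands junctions

-- The uniform theta graph

module Theta (t n : ℕ) (1≤t : 1 ≤ t) (1≤n : 1 ≤ n) where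
  open Strand {Fin 2} 0F 1F t n
  G : Graph
  G = theta t n
  open Graph G

  edge : ∀ i {j} → j < suc n → strand i j ~ strand i (suc j)
  edge i {zero} _ = subst (inj₁ 0F ~_) (sym (strand-inner i 1≤n))
    (fwd (toFirst (Fin.toℕ-fromℕ< 1≤n)))
  edge i {suc j} (s≤s j<n) with ℕ.m≤n⇒m<n∨m≡n j<n
  ... | inj₁ j+1<n = subst₂ _~_ (sym (strand-inner i j<n)) (sym (strand-inner i j+1<n))
    (fwd (inPath (fwd (trans (cong suc (Fin.toℕ-fromℕ< j<n)) (sym (Fin.toℕ-fromℕ< j+1<n))))))
  ... | inj₂ refl = subst₂ _~_ (sym (strand-inner i j<n)) (sym (strand-last i))
    (bwd (toSecond (cong suc (Fin.toℕ-fromℕ< j<n))))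

  Covered : V → V → Set
  Covered x y = ∃[ i ] ∃[ j ] (j < suc n ×
                ((x ≡ strand i j × y ≡ strand i (suc j)) ⊎
                 (y ≡ strand i j × x ≡ strand i (suc j))))

  Covered-sym : ∀ {x y} → Covered x y → Covered y x
  Covered-sym (i , j , j<L , c) = i , j , j<L , Sum.swap c

  cover-path : ∀ i {j k} → PathNext n j k → Covered (inj₂ (i , j)) (inj₂ (i , k))
  cover-path i {j} {k} next = i , suc (toℕ j) , s≤s (Fin.toℕ<n j) ,
    inj₁ (strand-toℕ i j , trans (strand-toℕ i k) (cong (strand i ∘ suc) (sym next)))

  cover-edge : ∀ {x y} → ThetaEdge t n x y → Covered x y
  cover-edge (inPath (fwd next)) = cover-path _ next
  cover-edge (inPath (bwd next)) = Covered-sym (cover-path _ next)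
  cover-edge (toFirst {i} {j} first) =
    i , 0 , ℕ.z<s , inj₁ (refl , trans (strand-toℕ i j) (cong (strand i ∘ suc) first))
  cover-edge (toSecond {i} {j} last) =
    i , suc (toℕ j) , s≤s (Fin.toℕ<n j) ,
    inj₂ (strand-toℕ i j , sym (trans (cong (strand i ∘ suc) last) (strand-last i)))

  cover : ∀ {x y} → x ~ y → Covered x y
  cover (fwd e) = cover-edge e
  cover (bwd e) = Covered-sym (cover-edge e)

  strands : Strands G
  strands = record
    { t = t ; m = n ; 0<m = 1≤n
    ; point = strand ; point-edge = edge ; point-cover = cover
    -- The two ends are different vertices, so strands with a single inner vertex are allowed.
    ; point-interior = strand-interior ; point-turn = strand-turn (inj₁ λ ())
    }

  open Strands strands using (pt; L; K)

  pt-start : ∀ κ → pt κ 0 ≡ inj₁ (proj₂ κ)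
  pt-start (i , 0F) = refl
  pt-start (i , 1F) = strand-last i

  pt-finish : ∀ κ → pt κ L ≡ inj₁ (opposite (proj₂ κ))
  pt-finish (i , 0F) = strand-last i
  pt-finish (i , 1F) = cong (strand i) (ℕ.n∸n≡0 n)

  -- The direction of a strand is also the index of the end that it leaves, so the arrivals at end
  -- `s` are the strands that leave `opposite s`.
  arriving : K → Fin t → K
  arriving (_ , s) k = k , opposite s

  arriving-complete : ∀ κ κ′ → pt κ′ L ≡ pt κ 0 → ∃[ k ] arriving κ k ≡ κ′
  arriving-complete κ κ′@(i , s) eq = i , cong (i ,_) (trans
    (cong opposite (sym (Sum.inj₁-injective (trans (sym (pt-finish κ′)) (trans eq (pt-start κ))))))
    (Fin.opposite-involutive s))

  strand₀ : Fin t
  strand₀ = fromℕ< 1≤t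

  junctions : Junctions strands
  junctions = record
    { d = t
    ; d-nonZero = ℕ.>-nonZero 1≤t
    ; inc = arriving
    ; inc-inj = λ _ → cong proj₁
    ; inc-end = λ κ k → trans (pt-finish (arriving κ k))
        (trans (cong inj₁ (Fin.opposite-involutive (proj₂ κ))) (sym (pt-start κ)))
    ; inc-complete = arriving-complete
    -- Both sides of either law are the same strand index with `opposite` applied twice to the
    -- direction.
    ; inc-inc = λ _ _ _ → refl
    ; inc-rev = λ _ _ → refl
    ; start = strand₀ , 0F
    ; scatter-start = no-fixed
    }
    where
    c : ℚ
    c = twoOver t ⦃ ℕ.>-nonZero 1≤t ⦄

    -- Only strands of direction `1F` contribute to the scattered value at the starting strand, and
    -- `f` vanishes on all of them; so that value is 0 instead of 1.
    no-fixed : (f : K → ℚ) → f (strand₀ , 0F) ≡ 1ℚ →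
               (∀ κ → κ ≢ (strand₀ , 0F) → f κ ≡ 0ℚ) →
               ¬ (∀ κ → c *ℚ sum (f ∘ arriving κ) -ℚ f (rev κ) ≡ f κ)
    no-fixed f f≡1 f≡0 fixed = contradiction 1≡0 λ ()
      where
      open ≡-Reasoning
      1≡0 : 1ℚ ≡ 0ℚ
      1≡0 = begin
        1ℚ                            ≡⟨ f≡1 ⟨
        f (strand₀ , 0F)              ≡⟨ fixed (strand₀ , 0F) ⟨
        c *ℚ sum (λ k → f (k , 1F)) -ℚ f (strand₀ , 1F)
          ≡⟨ cong₂ (λ u v → c *ℚ u -ℚ v) (ℚ-Sum.sum-zero λ k → f≡0 (k , 1F) λ ())
                                         (f≡0 (strand₀ , 1F) λ ()) ⟩
        c *ℚ 0ℚ -ℚ 0ℚ                 ≡⟨ cong (_-ℚ 0ℚ) (ℚ.*-zeroʳ c) ⟩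
        0ℚ                            ∎

  periodic : IsPeriodic G (2 * n + 2)
  periodic = subst (IsPeriodic G)
    (trans (ℕ.*-suc 2 n) (ℕ.+-comm 2 (2 * n)))
    (Evolution.periodic strands junctions)

theorem1p1 :
    (∀ (t n : ℕ) → 2 ≤ t → (3≤n : 3 ≤ n) → IsPeriodic (windmill t n 3≤n) (2 * n))
    × (∀ (t n : ℕ) → 1 ≤ t → 1 ≤ n → IsPeriodic (theta t n) (2 * n + 2))
theorem1p1 = (λ { t (suc m) 2≤t 3≤n → Windmill.periodic t m 2≤t 3≤n }) , Theta.periodic
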